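{- Let $G$ be a finite non-abelian group (written additively) of even order $n$ which possesses a subgroup of index $2$. Then (i) if $n=6$, $cr(G)=cr(S_3)=4$, where $S_3$ is the symmetric group on three letters; (ii) otherwise, $cr(G)=n/2$.
   Context: For a finite additively written group $G$ with identity $0$ and a subset $S=\{a_1,\dots,a_k\}\subseteq G\setminus\{0\}$, let $\sum(S)=\{a_{i_1}+\cdots+a_{i_l} : 1\le l\le k,\ i_1,\dots,i_l \text{ pairwise distinct}\}$ (all sums of distinct elements of $S$, taken in any order). $S$ is an additive basis of $G$ if $\sum(S)=G$. The critical number $cr(G)$ is the smallest integer $t$ such that every subset $S\subseteq G\setminus\{0\}$ with $|S|\ge t$ is an additive basis of $G$. -}

module Defs where

open import Data.Nat using (ℕ; _≤_; _*_)
open import Data.Fin using (Fin)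
open import Data.Fin.Subset using (Subset; _∈_; _∉_; ∣_∣)
open import Data.List using (List; []; foldr)
open import Data.List.Relation.Unary.All using (All)
open import Data.List.Relation.Unary.Unique.Propositional using (Unique)
open import Data.Product using (Σ; ∃; _×_)
open import Relation.Binary.PropositionalEquality using (_≡_; _≢_)
open import Algebra.Core using (Op₁; Op₂)
open import Algebra.Structures using (IsGroup)

-- A finite group of order n, presented (up to isomorphism) as a group
-- structure on the n-element set Fin n, with propositional equality.
-- The group is written additively in the paper; we call the operation _∙_
-- and the identity ε ("0").
record FinGroup (n : ℕ) : Set where
  field
    _∙_     : Op₂ (Fin n)
    ε       : Fin n
    _⁻¹     : Op₁ (Fin n)
    isGroup : IsGroup _≡_ _∙_ ε _⁻¹

module _ {n : ℕ} (G : FinGroup n) where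
  open FinGroup G

  IsAbelian : Set
  IsAbelian = ∀ x y → (x ∙ y) ≡ (y ∙ x)

  IsSubgroup : Subset n → Set
  IsSubgroup H = (ε ∈ H)
               × (∀ x y → x ∈ H → y ∈ H → (x ∙ y) ∈ H)
               × (∀ x → x ∈ H → (x ⁻¹) ∈ H)

  HasSubgroupOfIndex2 : Set
  HasSubgroupOfIndex2 = Σ (Subset n) λ H → IsSubgroup H × (∣ H ∣ * 2 ≡ n)

  sumList : List (Fin n) → Fin n
  sumList = foldr _∙_ ε

  InSums : Subset n → Fin n → Set
  InSums S g = ∃ λ (xs : List (Fin n)) →
                 (xs ≢ []) × Unique xs × All (_∈ S) xs × (sumList xs ≡ g)

  IsAdditiveBasis : Subset n → Set
  IsAdditiveBasis S = ∀ g → InSums S g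

  CritBound : ℕ → Set
  CritBound t = ∀ (S : Subset n) → ε ∉ S → t ≤ ∣ S ∣ → IsAdditiveBasis S

  IsCriticalNumber : ℕ → Set
  IsCriticalNumber t = CritBound t × (∀ t′ → CritBound t′ → t ≤ t′)

{-# OPTIONS --safe #-}
-- Let H be the subgroup of index 2, K its complement, m = n/2, A = {0} ∪ (S ∩ H) and B = S ∩ K, so that
-- |A| + |B| > m.  By pigeonhole A + B ⊇ K.  Suppose g ∈ H is not a sum.  For each y ∈ B the set of all
-- g - y - z with z ∈ B ∖ {y} lies in H and misses A; counting shows that it is the complement of A in H, so
-- A is closed under sums of distinct elements.  If A = {0} then B = K and every element of K is a
-- square root of g, and g is written as a sum of four elements of K.  Otherwise |B| ≤ |A|, so
-- H = A + A; then either A = H, or A = {0, x, - x} with m ≤ 5, which forces G to be abelian.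
-- H ∖ {0}, and K when n = 6, show that the bounds are sharp.
module Submission where

open import Defs
open import Algebra.Bundles using (Group)
open import Data.Bool as Bool using (Bool; true; false; not)
open import Data.Empty using (⊥)
open import Data.Fin using (Fin; zero; suc; _≟_)
import Data.Fin.Properties as Fin
open import Data.Fin.Subset using (Subset; inside; outside; _∈_; _∉_; ∣_∣; ∁; _∩_; ⁅_⁆)
open import Data.Fin.Subset.Properties
  using (drop-there; _∈?_; ∣∁p∣≡n∸∣p∣; x∈∁p⇒x∉p; x∉p⇒x∈∁p; x∈p⇒x∉∁p; x∈p∩q⁺; x∈p∩q⁻; x∈⁅x⁆; x≢y⇒x∉⁅y⁆)
open import Data.List using (List; []; _∷_; _++_; length; map; filter; allFin)
open import Data.List.Properties using (length-++; length-map; length-tabulate; ++-conicalˡ)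
open import Data.List.Membership.Propositional using (find; lose) renaming (_∈_ to _∈ˡ_; _∉_ to _∉ˡ_)
open import Data.List.Membership.Propositional.Properties
  using (∈-∃++; ∈-++⁺ˡ; ∈-++⁺ʳ; ∈-++⁻; ∈-map⁺; ∈-map⁻; ∈-filter⁺; ∈-filter⁻; ∈-allFin; ∈-length)
import Data.List.Membership.DecPropositional as DecMembership
open import Data.List.Relation.Unary.All as All using (All; []; _∷_)
open import Data.List.Relation.Unary.Any using (here; there; any?)
open import Data.List.Relation.Unary.AllPairs using ([]; _∷_)
import Data.List.Relation.Unary.All.Properties as All
import Data.List.Relation.Unary.Unique.DecPropositional as DecUnique
open import Data.List.Relation.Unary.Unique.Propositional using (Unique)
import Data.List.Relation.Unary.Unique.Propositional.Properties as Unique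
open import Data.Nat using (ℕ; zero; suc; _+_; _*_; _∸_; _/_; _≤_; _<_; z≤n; s≤s)
open import Data.Nat.Properties
  using (≤-trans; ≤-reflexive; +-suc; +-comm; <⇒≱; ≤-pred; n≤1+n; +-identityʳ; *-comm; m+n∸m≡n;
         +-monoʳ-≤; +-cancelˡ-≤; suc-injective; ≮⇒≥; *-cancelʳ-≡; m≤m+n; +-monoˡ-≤; +-mono-≤;
         module ≤-Reasoning)
open import Data.Product using (∃; ∃₂; _×_; _,_; proj₁; proj₂)
open import Data.Sum using (_⊎_; inj₁; inj₂)
open import Data.Vec as Vec using (Vec; lookup; []; _∷_)
open import Function using (_∘_; id)
open import Level using (Level)
open import Relation.Binary.Definitions using (DecidableEquality)
open import Relation.Nullary using (¬_; Dec; yes; no; ¬?; contradiction)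
open import Relation.Nullary.Decidable using (map′; _×-dec_; _⊎-dec_; decidable-stable)
open import Relation.Unary using (Pred; Decidable)
open import Relation.Binary.PropositionalEquality
  using (_≡_; _≢_; refl; sym; trans; cong; cong₂; subst; module ≡-Reasoning; subst₂)
open import Data.Nat.DivMod using (m*n/n≡m)
open import Data.Nat.Divisibility using (_∣_)

private variable
  a p : Level
  X : Set a
  n : ℕ

-- Duplicate-free lists as finite sets

length-mono : {xs ys : List X} → Unique xs → (∀ {x} → x ∈ˡ xs → x ∈ˡ ys) → length xs ≤ length ys
length-mono {xs = []} _ _ = z≤n
length-mono {xs = x ∷ xs} {ys} (x∉xs ∷ uxs) sub with ∈-∃++ (sub (here refl))
... | as , bs , refl = subst (suc (length xs) ≤_) (sym len) (s≤s (length-mono uxs sub′))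
  where
  len : length (as ++ x ∷ bs) ≡ suc (length (as ++ bs))
  len = trans (length-++ as) (trans (+-suc (length as) (length bs)) (cong suc (sym (length-++ as))))
  sub′ : ∀ {z} → z ∈ˡ xs → z ∈ˡ as ++ bs
  sub′ z∈xs with ∈-++⁻ as (sub (there z∈xs))
  ... | inj₁ z∈as         = ∈-++⁺ˡ z∈as
  ... | inj₂ (here refl)  = contradiction refl (All.lookup x∉xs z∈xs)
  ... | inj₂ (there z∈bs) = ∈-++⁺ʳ as z∈bs

length-filter-¬ : {P : Pred X p} (P? : Decidable P) (xs : List X) →
  length (filter P? xs) + length (filter (¬? ∘ P?) xs) ≡ length xs
length-filter-¬ P? [] = refl
length-filter-¬ P? (x ∷ xs) with P? x
... | yes _ = cong suc (length-filter-¬ P? xs)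
... | no _  = trans (+-suc _ _) (cong suc (length-filter-¬ P? xs))

abstract
  counterexample? : {P : Pred X p} → Decidable P → (xs : List X) →
    (∃ λ x → x ∈ˡ xs × ¬ P x) ⊎ (∀ {x} → x ∈ˡ xs → P x)
  counterexample? P? xs with any? (¬? ∘ P?) xs
  ... | yes p = inj₁ (find p)
  ... | no ¬p = inj₂ λ x∈ → decidable-stable (P? _) λ ¬Px → ¬p (lose x∈ ¬Px)

module _ {X : Set a} (_≟_ : DecidableEquality X) where
  open DecMembership _≟_ using () renaming (_∈?_ to _∈ˡ?_)

  abstract
    -- A `y` missing from `xs` could be consed onto it, giving a duplicate-free list inside `ys`
    -- that is too long.
    ⊆-of-length : {xs ys : List X} → Unique xs → (∀ {x} → x ∈ˡ xs → x ∈ˡ ys) → length ys ≤ length xs →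
      ∀ {y} → y ∈ˡ ys → y ∈ˡ xs
    ⊆-of-length {xs} {ys} uxs sub ys≤xs {y} y∈ys with y ∈ˡ? xs
    ... | yes y∈xs = y∈xs
    ... | no y∉xs  = contradiction ys≤xs (<⇒≱ (length-mono (y#xs ∷ uxs) sub′))
      where
      y#xs : All (y ≢_) xs
      y#xs = All.tabulate λ z∈xs y≡z → y∉xs (subst (_∈ˡ xs) (sym y≡z) z∈xs)
      sub′ : ∀ {z} → z ∈ˡ y ∷ xs → z ∈ˡ ys
      sub′ (here refl) = y∈ys
      sub′ (there z∈)  = sub z∈

  abstract
    escape : (xs : List X) {ys : List X} → Unique ys → length xs < length ys → ∃ λ y → y ∈ˡ ys × y ∉ˡ xs
    escape xs {ys} uys xs<ys with counterexample? (_∈ˡ? xs) ys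
    ... | inj₁ p      = p
    ... | inj₂ ys⊆xs = contradiction (length-mono uys ys⊆xs) (<⇒≱ xs<ys)

  abstract
    -- If the lists were disjoint, `xs ++ ys` would be duplicate-free and contained in the shorter
    -- `zs`.
    common-element : {xs ys : List X} (zs : List X) → Unique xs → Unique ys →
      (∀ {x} → x ∈ˡ xs → x ∈ˡ zs) → (∀ {y} → y ∈ˡ ys → y ∈ˡ zs) →
      length zs < length xs + length ys → ∃ λ z → z ∈ˡ xs × z ∈ˡ ys
    common-element {xs} {ys} zs uxs uys xs⊆ ys⊆ zs< with any? (_∈ˡ? ys) xs
    ... | yes p = find p
    ... | no ¬p = contradiction (≤-trans (≤-reflexive (sym (length-++ xs))) (length-mono u sub)) (<⇒≱ zs<)
      where
      u : Unique (xs ++ ys)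
      u = Unique.++⁺ uxs uys λ (z∈xs , z∈ys) → ¬p (lose z∈xs z∈ys)
      sub : ∀ {z} → z ∈ˡ xs ++ ys → z ∈ˡ zs
      sub z∈ with ∈-++⁻ xs z∈
      ... | inj₁ z∈xs = xs⊆ z∈xs
      ... | inj₂ z∈ys = ys⊆ z∈ys

  remove : X → List X → List X
  remove y = filter (λ z → ¬? (z ≟ y))

  length-remove : ∀ y {xs} → Unique xs → length xs ≤ suc (length (remove y xs))
  length-remove y {xs} uxs = length-mono uxs sub
    where
    sub : ∀ {z} → z ∈ˡ xs → z ∈ˡ y ∷ remove y xs
    sub {z} z∈ with z ≟ y
    ... | yes z≡y = here z≡y
    ... | no z≢y  = there (∈-filter⁺ _ z∈ z≢y)

-- Subsets as duplicate-free lists, and bounded search over lists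

elements : Subset n → List (Fin n)
elements []            = []
elements (inside ∷ S)  = zero ∷ map suc (elements S)
elements (outside ∷ S) = map suc (elements S)

length-elements : (S : Subset n) → length (elements S) ≡ ∣ S ∣
length-elements []            = refl
length-elements (inside ∷ S)  = cong suc (trans (length-map suc (elements S)) (length-elements S))
length-elements (outside ∷ S) = trans (length-map suc (elements S)) (length-elements S)

∈-elements⁺ : {S : Subset n} {x : Fin n} → x ∈ S → x ∈ˡ elements S
∈-elements⁺ {S = inside ∷ S}  {zero}  _  = here refl
∈-elements⁺ {S = inside ∷ S}  {suc x} x∈ = there (∈-map⁺ suc (∈-elements⁺ (drop-there x∈)))
∈-elements⁺ {S = outside ∷ S} {suc x} x∈ = ∈-map⁺ suc (∈-elements⁺ (drop-there x∈))

∈-elements⁻ : {S : Subset n} {x : Fin n} → x ∈ˡ elements S → x ∈ S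
∈-elements⁻ {S = inside ∷ S} (here refl) = Vec.here
∈-elements⁻ {S = inside ∷ S} (there x∈) with ∈-map⁻ suc x∈
... | _ , y∈ , refl = Vec.there (∈-elements⁻ y∈)
∈-elements⁻ {S = outside ∷ S} x∈ with ∈-map⁻ suc x∈
... | _ , y∈ , refl = Vec.there (∈-elements⁻ y∈)

elements-unique : (S : Subset n) → Unique (elements S)
elements-unique [] = []
elements-unique (inside ∷ S) =
  All.map⁺ (All.universal (λ _ ()) _) ∷ Unique.map⁺ Fin.suc-injective (elements-unique S)
elements-unique (outside ∷ S) = Unique.map⁺ Fin.suc-injective (elements-unique S)

abstract
  any-short-list? : {P : Pred (List (Fin n)) p} → Decidable P → ∀ k → Dec (∃ λ xs → length xs ≤ k × P xs)
  any-short-list? P? zero = map′ (λ p → [] , z≤n , p) (λ { ([] , _ , p) → p }) (P? [])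
  any-short-list? {P = P} P? (suc k) = map′ to from
    (P? [] ⊎-dec Fin.any? λ x → any-short-list? (λ xs → P? (x ∷ xs)) k)
    where
    to : P [] ⊎ (∃ λ x → ∃ λ xs → length xs ≤ k × P (x ∷ xs)) → ∃ λ xs → length xs ≤ suc k × P xs
    to (inj₁ p)                = [] , z≤n , p
    to (inj₂ (x , xs , l , p)) = x ∷ xs , s≤s l , p
    from : (∃ λ xs → length xs ≤ suc k × P xs) → P [] ⊎ (∃ λ x → ∃ λ xs → length xs ≤ k × P (x ∷ xs))
    from ([] , _ , p)         = inj₁ p
    from (x ∷ xs , s≤s l , p) = inj₂ (x , xs , l , p)

-- Decision procedure for identities between group words

infixl 7 _⊕_
infix 8 ⊖_

data Word (k : ℕ) : Set where
  var : Fin k → Word k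
  𝟘   : Word k
  _⊕_ : Word k → Word k → Word k
  ⊖_  : Word k → Word k

-- `true` marks a generator and `false` its inverse.
Literal : ℕ → Set
Literal k = Bool × Fin k

push : ∀ {k} → Literal k → List (Literal k) → List (Literal k)
push l [] = l ∷ []
push (s , i) ((t , j) ∷ ls) with i Fin.≟ j | s Bool.≟ not t
... | yes _ | yes _ = ls
... | _     | _     = (s , i) ∷ (t , j) ∷ ls

-- Free reduction with an accumulator: `push` cancels against the head of `ls`, so a freely reduced
-- `ls` stays so. The flag is `false` under a pending inverse, which reverses the order of the
-- factors.
reduce : ∀ {k} → Bool → Word k → List (Literal k) → List (Literal k)
reduce s     (var i) ls = push (s , i) ls
reduce s     𝟘       ls = ls
reduce true  (v ⊕ w) ls = reduce true v (reduce true w ls)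
reduce false (v ⊕ w) ls = reduce false w (reduce false v ls)
reduce s     (⊖ w)   ls = reduce (not s) w ls

module GroupWords {c ℓ} (𝔾 : Group c ℓ) where
  open Group 𝔾 renaming (refl to ≈-refl; sym to ≈-sym; trans to ≈-trans)
  open import Algebra.Properties.Group 𝔾
  open import Relation.Binary.Reasoning.Setoid setoid

  private variable
    k : ℕ

  ⟦_⟧ : Word k → Vec Carrier k → Carrier
  ⟦ var i ⟧ ρ = lookup ρ i
  ⟦ 𝟘 ⟧     ρ = ε
  ⟦ v ⊕ w ⟧ ρ = ⟦ v ⟧ ρ ∙ ⟦ w ⟧ ρ
  ⟦ ⊖ w ⟧   ρ = ⟦ w ⟧ ρ ⁻¹

  signed : Bool → Carrier → Carrier
  signed true  x = x
  signed false x = x ⁻¹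

  evaluate : List (Literal k) → Vec Carrier k → Carrier
  evaluate []             ρ = ε
  evaluate ((s , i) ∷ ls) ρ = signed s (lookup ρ i) ∙ evaluate ls ρ

  signed-cancel : ∀ t x y → signed (not t) x ∙ (signed t x ∙ y) ≈ y
  signed-cancel true  x y = \\-leftDividesʳ x y
  signed-cancel false x y = \\-leftDividesˡ x y

  push-sound : ∀ (l : Literal k) ls ρ → evaluate (push l ls) ρ ≈ evaluate (l ∷ ls) ρ
  push-sound l [] ρ = ≈-refl
  push-sound (s , i) ((t , j) ∷ ls) ρ with i Fin.≟ j | s Bool.≟ not t
  ... | yes refl | yes refl = ≈-sym (signed-cancel t (lookup ρ i) (evaluate ls ρ))
  ... | yes _        | no _         = ≈-refl
  ... | no _         | yes _        = ≈-refl
  ... | no _         | no _         = ≈-refl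

  reduce-sound : ∀ s (w : Word k) ls ρ → evaluate (reduce s w ls) ρ ≈ signed s (⟦ w ⟧ ρ) ∙ evaluate ls ρ
  reduce-sound s     (var i) ls ρ = push-sound (s , i) ls ρ
  reduce-sound true  𝟘       ls ρ = ≈-sym (identityˡ _)
  reduce-sound false 𝟘       ls ρ = ≈-sym (≈-trans (∙-congʳ ε⁻¹≈ε) (identityˡ _))
  reduce-sound true  (v ⊕ w) ls ρ = begin
    evaluate (reduce true v (reduce true w ls)) ρ  ≈⟨ reduce-sound true v _ ρ ⟩
    ⟦ v ⟧ ρ ∙ evaluate (reduce true w ls) ρ        ≈⟨ ∙-congˡ (reduce-sound true w ls ρ) ⟩
    ⟦ v ⟧ ρ ∙ (⟦ w ⟧ ρ ∙ evaluate ls ρ)            ≈⟨ assoc _ _ _ ⟨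
    ⟦ v ⊕ w ⟧ ρ ∙ evaluate ls ρ                    ∎
  reduce-sound false (v ⊕ w) ls ρ = begin
    evaluate (reduce false w (reduce false v ls)) ρ  ≈⟨ reduce-sound false w _ ρ ⟩
    ⟦ w ⟧ ρ ⁻¹ ∙ evaluate (reduce false v ls) ρ      ≈⟨ ∙-congˡ (reduce-sound false v ls ρ) ⟩
    ⟦ w ⟧ ρ ⁻¹ ∙ (⟦ v ⟧ ρ ⁻¹ ∙ evaluate ls ρ)        ≈⟨ assoc _ _ _ ⟨
    (⟦ w ⟧ ρ ⁻¹ ∙ ⟦ v ⟧ ρ ⁻¹) ∙ evaluate ls ρ        ≈⟨ ∙-congʳ (⁻¹-anti-homo-∙ _ _) ⟨
    ⟦ v ⊕ w ⟧ ρ ⁻¹ ∙ evaluate ls ρ                   ∎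
  reduce-sound true  (⊖ w)   ls ρ = reduce-sound false w ls ρ
  reduce-sound false (⊖ w)   ls ρ =
    ≈-trans (reduce-sound true w ls ρ) (∙-congʳ (≈-sym (⁻¹-involutive _)))

  -- The hypothesis compares normal forms in the free group, so for concrete words `refl` proves it
  -- whenever the identity holds in all groups.
  solve : (ρ : Vec Carrier k) (v w : Word k) → reduce true v [] ≡ reduce true w [] → ⟦ v ⟧ ρ ≈ ⟦ w ⟧ ρ
  solve ρ v w eq = begin
    ⟦ v ⟧ ρ                        ≈⟨ identityʳ _ ⟨
    ⟦ v ⟧ ρ ∙ ε                    ≈⟨ reduce-sound true v [] ρ ⟨
    evaluate (reduce true v []) ρ  ≡⟨ cong (λ ls → evaluate ls ρ) eq ⟩
    evaluate (reduce true w []) ρ  ≈⟨ reduce-sound true w [] ρ ⟩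
    ⟦ w ⟧ ρ ∙ ε                    ≈⟨ identityʳ _ ⟩
    ⟦ w ⟧ ρ                        ∎

pattern v0 = var zero
pattern v1 = var (suc zero)
pattern v2 = var (suc (suc zero))
pattern v3 = var (suc (suc (suc zero)))

-- Finite groups: deciding sums, and subsets larger than half of the group

module FiniteGroup {n : ℕ} (G : FinGroup n) where
  group : Group _ _
  group = record { isGroup = FinGroup.isGroup G }

  open Group group public using (_∙_; ε; _⁻¹; assoc; identityˡ; identityʳ; inverseˡ; inverseʳ)
  open import Algebra.Properties.Group group public
  open GroupWords group public using (solve)
  open DecMembership (_≟_ {n}) public using () renaming (_∈?_ to _∈ˡ?_)

  -- A duplicate-free list over `Fin n` has at most `n` entries, so a bounded search suffices.
  -- Decidability is what permits arguing by contradiction from an element that is not a sum.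
  sums? : ∀ S g → Dec (InSums G S g)
  sums? S g = map′ (λ (xs , _ , p) → xs , p) (λ (xs , p) → xs , short xs (proj₁ (proj₂ p)) , p)
    (any-short-list? P? n)
    where
    open DecUnique (_≟_ {n}) using (unique?)
    nonempty? : (xs : List (Fin n)) → Dec (xs ≢ [])
    nonempty? []       = no λ p → p refl
    nonempty? (x ∷ xs) = yes λ ()
    P? = λ xs → nonempty? xs ×-dec unique? xs ×-dec All.all? (_∈? S) xs ×-dec (sumList G xs ≟ g)
    short : ∀ xs → Unique xs → length xs ≤ n
    short xs u = subst (length xs ≤_) (length-tabulate id) (length-mono u λ _ → ∈-allFin _)

  move-right : ∀ x y z → x ≡ z ∙ y ⁻¹ → x ∙ y ≡ z
  move-right x y z refl = solve (z ∷ y ∷ []) ((v0 ⊕ ⊖ v1) ⊕ v1) v0 refl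

  abstract
    -- Both X and g - Y lie in Z and their sizes add up to more than |Z|, so they meet; a common
    -- element x = g - y gives x + y = g.
    cover : ∀ {xs ys} (zs : List (Fin n)) {g} → Unique xs → Unique ys → (∀ {x} → x ∈ˡ xs → x ∈ˡ zs) →
      (∀ {y} → y ∈ˡ ys → g ∙ y ⁻¹ ∈ˡ zs) → length zs < length xs + length ys →
      ∃₂ λ x y → x ∈ˡ xs × y ∈ˡ ys × x ∙ y ≡ g
    cover {xs} {ys} zs {g} uxs uys xs⊆ ys⊆ zs<
      with common-element _≟_ zs uxs (Unique.map⁺ inj uys) xs⊆ sub
             (subst (λ l → length zs < length xs + l) (sym (length-map _ ys)) zs<)
      where
      inj : ∀ {x y} → g ∙ x ⁻¹ ≡ g ∙ y ⁻¹ → x ≡ y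
      inj eq = ⁻¹-injective (∙-cancelˡ g _ _ eq)
      sub : ∀ {z} → z ∈ˡ map (λ y → g ∙ y ⁻¹) ys → z ∈ˡ zs
      sub z∈ with ∈-map⁻ _ z∈
      ... | y , y∈ , refl = ys⊆ y∈
    ... | z , z∈xs , z∈ with ∈-map⁻ _ z∈
    ... | y , y∈ys , z≡ = z , y , z∈xs , y∈ys , move-right z y g z≡

  Closed : (Fin n → Set) → Set
  Closed P = ∀ {x y} → P x → P y → P (x ∙ y)

  -- By `cover` inside the whole group, L + L = G once |L| > n/2. This stands in for Lagrange's
  -- theorem.
  closed-large : {P : Fin n → Set} → Closed P → (L : List (Fin n)) → Unique L →
    n < length L + length L → All P L → ∀ g → P g
  closed-large {P} ∙P L uL n< PL g
    with cover (allFin n) {g} uL uL (λ _ → ∈-allFin _) (λ _ → ∈-allFin _)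
           (subst (_< length L + length L) (sym (length-tabulate id)) n<)
  ... | x , y , x∈ , y∈ , refl = ∙P (All.lookup PL x∈) (All.lookup PL y∈)

  comm-∙ : ∀ {x y z} → x ∙ z ≡ z ∙ x → y ∙ z ≡ z ∙ y → (x ∙ y) ∙ z ≡ z ∙ (x ∙ y)
  comm-∙ {x} {y} {z} p q = begin
    (x ∙ y) ∙ z  ≡⟨ assoc x y z ⟩
    x ∙ (y ∙ z)  ≡⟨ cong (x ∙_) q ⟩
    x ∙ (z ∙ y)  ≡⟨ assoc x z y ⟨
    (x ∙ z) ∙ y  ≡⟨ cong (_∙ y) p ⟩
    (z ∙ x) ∙ y  ≡⟨ assoc z x y ⟩
    z ∙ (x ∙ y)  ∎
    where open ≡-Reasoning

  comm-⁻¹ : ∀ {x z} → x ∙ z ≡ z ∙ x → x ⁻¹ ∙ z ≡ z ∙ x ⁻¹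
  comm-⁻¹ {x} {z} p = begin
    x ⁻¹ ∙ z                  ≡⟨ solve (x ∷ z ∷ []) (⊖ v0 ⊕ v1) (⊖ v0 ⊕ (v1 ⊕ v0) ⊕ ⊖ v0) refl ⟩
    (x ⁻¹ ∙ (z ∙ x)) ∙ x ⁻¹   ≡⟨ cong (λ w → (x ⁻¹ ∙ w) ∙ x ⁻¹) p ⟨
    (x ⁻¹ ∙ (x ∙ z)) ∙ x ⁻¹   ≡⟨ solve (x ∷ z ∷ []) (⊖ v0 ⊕ (v0 ⊕ v1) ⊕ ⊖ v0) (v1 ⊕ ⊖ v0) refl ⟩
    z ∙ x ⁻¹                  ∎
    where open ≡-Reasoning

  comm-ε : ∀ {z} → ε ∙ z ≡ z ∙ ε
  comm-ε {z} = trans (identityˡ z) (sym (identityʳ z))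

  -- `closed-large` is applied twice: the centralizer of each element of `L` contains `L`, hence is
  -- G; so the centre contains `L`, hence is G.
  commuting-large : (L : List (Fin n)) → Unique L → n < length L + length L →
    (∀ {a b} → a ∈ˡ L → b ∈ˡ L → a ∙ b ≡ b ∙ a) → IsAbelian G
  commuting-large L uL n< comm x y = closed-large {P = λ z → ∀ w → z ∙ w ≡ w ∙ z}
    (λ p q w → comm-∙ (p w) (q w)) L uL n< (All.tabulate λ b∈ w → sym (central b∈ w)) x y
    where
    central : ∀ {b} → b ∈ˡ L → ∀ z → z ∙ b ≡ b ∙ z
    central b∈ = closed-large comm-∙ L uL n< (All.tabulate λ a∈ → comm a∈ b∈)

  -- Quantifying over all closed predicates `P` says that `L` lies in the subgroup generated by `x`
  -- and `k`. Only centralizers are used as `P`: first of `x` and of `k`, then of each element of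
  -- `L`.
  two-generated-large : ∀ {x k} → x ∙ k ≡ k ∙ x → (L : List (Fin n)) → Unique L → n < length L + length L →
    (∀ (P : Fin n → Set) → P ε → Closed P → (∀ {z} → P z → P (z ⁻¹)) → P x → P k → All P L) → IsAbelian G
  two-generated-large {x} {k} xk L uL n< gen = commuting-large L uL n< λ {a} {b} a∈ b∈ →
    All.lookup (commuting (x-commutes b∈) (k-commutes b∈)) a∈
    where
    commuting : ∀ {z} → x ∙ z ≡ z ∙ x → k ∙ z ≡ z ∙ k → All (λ a → a ∙ z ≡ z ∙ a) L
    commuting {z} = gen (λ a → a ∙ z ≡ z ∙ a) comm-ε comm-∙ comm-⁻¹
    x-commutes : ∀ {b} → b ∈ˡ L → x ∙ b ≡ b ∙ x
    x-commutes b∈ = sym (All.lookup (commuting refl (sym xk)) b∈)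
    k-commutes : ∀ {b} → b ∈ˡ L → k ∙ b ≡ b ∙ k
    k-commutes b∈ = sym (All.lookup (commuting xk refl) b∈)

  noncommuting-pair : ¬ IsAbelian G → ∃₂ λ x y → x ∙ y ≢ y ∙ x
  noncommuting-pair ¬ab with Fin.any? (λ x → Fin.any? (λ y → ¬? (x ∙ y ≟ y ∙ x)))
  ... | yes (x , y , p) = x , y , p
  ... | no ¬p = contradiction (λ x y → decidable-stable (x ∙ y ≟ y ∙ x) λ q → ¬p (x , y , q)) ¬ab

  x≢xy : ∀ {x y} → y ≢ ε → x ≢ x ∙ y
  x≢xy {x} {y} y≢ε p = y≢ε (identityʳ-unique x y (sym p))

  x≢yx : ∀ {x y} → y ≢ ε → x ≢ y ∙ x
  x≢yx {x} {y} y≢ε p = y≢ε (identityˡ-unique y x (sym p))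

  -- For non-commuting x and y the elements 0, x, y, x + y, y + x are distinct.
  nonabelian⇒5≤n : ¬ IsAbelian G → 5 ≤ n
  nonabelian⇒5≤n ¬ab with noncommuting-pair ¬ab
  ... | x , y , xy≢yx = subst (5 ≤_) (length-tabulate id)
    (length-mono {xs = ε ∷ x ∷ y ∷ x ∙ y ∷ y ∙ x ∷ []} {ys = allFin n}
      ((x≢ε ∘ sym ∷ y≢ε ∘ sym ∷ xy≢ε ∘ sym ∷ yx≢ε ∘ sym ∷ []) ∷
       (x≢y ∷ x≢xy y≢ε ∷ x≢yx y≢ε ∷ []) ∷
       (x≢yx x≢ε ∷ x≢xy x≢ε ∷ []) ∷
       (xy≢yx ∷ []) ∷ [] ∷ []) λ _ → ∈-allFin _)
    where
    x≢ε : x ≢ ε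
    x≢ε refl = xy≢yx comm-ε
    y≢ε : y ≢ ε
    y≢ε refl = xy≢yx (sym comm-ε)
    x≢y : x ≢ y
    x≢y refl = xy≢yx refl
    xy≢ε : x ∙ y ≢ ε
    xy≢ε p with inverseˡ-unique x y p
    ... | refl = xy≢yx (comm-⁻¹ refl)
    yx≢ε : y ∙ x ≢ ε
    yx≢ε p with inverseˡ-unique y x p
    ... | refl = xy≢yx (sym (comm-⁻¹ refl))

  -- Sets closed under sums of distinct elements

  module DistinctlyClosed (A : List (Fin n)) (uA : Unique A)
    (closed₂ : ∀ {x y} → x ∈ˡ A → y ∈ˡ A → x ≢ y → x ∙ y ∈ˡ A) where

    y∙∈ : ∀ {y} → y ∈ˡ A → y ∙ y ∈ˡ A → ∀ {a} → a ∈ˡ A → y ∙ a ∈ˡ A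
    y∙∈ {y} y∈ yy∈ {a} a∈ with y ≟ a
    ... | yes refl = yy∈
    ... | no y≢a   = closed₂ y∈ a∈ y≢a

    -- Translation by such a y permutes A.  If x + x ∉ A then x + y and - y + x cannot be distinct,
    -- whence x + x = y + (x + (y + x)).
    all-double : ∀ {y} → y ∈ˡ A → y ≢ ε → y ∙ y ∈ˡ A → ∀ {x} → x ∈ˡ A → x ∙ x ∈ˡ A
    all-double {y} y∈ y≢ε yy∈ {x} x∈ with x ≟ y
    ... | yes refl = yy∈
    ... | no x≢y with x ∙ y ≟ y ⁻¹ ∙ x
    ...   | no ≢ = subst (_∈ˡ A) (solve (x ∷ y ∷ []) ((v0 ⊕ v1) ⊕ (⊖ v1 ⊕ v0)) (v0 ⊕ v0) refl)
                     (closed₂ (closed₂ x∈ y∈ x≢y) (y⁻¹∙∈ x∈) ≢)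
      where
      map⊆ : ∀ {a} → a ∈ˡ map (y ∙_) A → a ∈ˡ A
      map⊆ a∈ with ∈-map⁻ _ a∈
      ... | _ , b∈ , refl = y∙∈ y∈ yy∈ b∈
      y⁻¹∙∈ : ∀ {a} → a ∈ˡ A → y ⁻¹ ∙ a ∈ˡ A
      y⁻¹∙∈ a∈ with ∈-map⁻ _ (⊆-of-length _≟_ (Unique.map⁺ (∙-cancelˡ y _ _) uA) map⊆
                                 (≤-reflexive (sym (length-map _ A))) a∈)
      ... | b , b∈ , refl = subst (_∈ˡ A) (solve (y ∷ b ∷ []) v1 (⊖ v0 ⊕ (v0 ⊕ v1)) refl) b∈
    ...   | yes xy≡ = subst (_∈ˡ A) eq (y∙∈ y∈ yy∈ (closed₂ x∈ (closed₂ y∈ x∈ (x≢y ∘ sym)) (x≢yx y≢ε)))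
      where
      eq : y ∙ (x ∙ (y ∙ x)) ≡ x ∙ x
      eq = begin
        y ∙ (x ∙ (y ∙ x))     ≡⟨ cong (y ∙_) (assoc x y x) ⟨
        y ∙ ((x ∙ y) ∙ x)     ≡⟨ cong (λ w → y ∙ (w ∙ x)) xy≡ ⟩
        y ∙ ((y ⁻¹ ∙ x) ∙ x)  ≡⟨ solve (x ∷ y ∷ []) (v1 ⊕ ((⊖ v1 ⊕ v0) ⊕ v0)) (v0 ⊕ v0) refl ⟩
        x ∙ x                 ∎
        where open ≡-Reasoning

    module _ (closed₃ : ∀ {x y z} → x ∈ˡ A → y ∈ˡ A → z ∈ˡ A → x ≢ y → x ≢ z → y ≢ z → x ∙ (y ∙ z) ∈ˡ A) where

      -- If z = x + y were nonzero, then x + y + z = z + z would be a sum of distinct elements.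
      opposite : (∀ {y} → y ∈ˡ A → y ≢ ε → y ∙ y ∉ˡ A) →
        ∀ {x y} → x ∈ˡ A → y ∈ˡ A → x ≢ ε → y ≢ ε → x ≢ y → x ∙ y ≡ ε
      opposite no-double {x} {y} x∈ y∈ x≢ε y≢ε x≢y with x ∙ y ≟ ε
      ... | yes p = p
      ... | no z≢ε = contradiction
        (subst (_∈ˡ A) (solve (x ∷ y ∷ []) (v0 ⊕ (v1 ⊕ (v0 ⊕ v1))) ((v0 ⊕ v1) ⊕ (v0 ⊕ v1)) refl)
          (closed₃ x∈ y∈ (closed₂ x∈ y∈ x≢y) x≢y (x≢xy y≢ε) (x≢yx x≢ε)))
        (no-double (closed₂ x∈ y∈ x≢y) z≢ε)

-- A subgroup H of index 2 and its complement K

module IndexTwo {n : ℕ} (G : FinGroup n) (H : Subset n) (H≤G : IsSubgroup G H) (index : ∣ H ∣ * 2 ≡ n) where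
  open FiniteGroup G

  m : ℕ
  m = ∣ H ∣

  n≡m+m : n ≡ m + m
  n≡m+m = trans (sym index) (trans (*-comm m 2) (cong (m +_) (+-identityʳ m)))

  Hˡ Kˡ : List (Fin n)
  Hˡ = elements H
  Kˡ = elements (∁ H)

  length-Hˡ : length Hˡ ≡ m
  length-Hˡ = length-elements H

  length-Kˡ : length Kˡ ≡ m
  length-Kˡ = begin
    length Kˡ  ≡⟨ length-elements (∁ H) ⟩
    ∣ ∁ H ∣    ≡⟨ ∣∁p∣≡n∸∣p∣ H ⟩
    n ∸ m      ≡⟨ cong (_∸ m) n≡m+m ⟩
    m + m ∸ m  ≡⟨ m+n∸m≡n m m ⟩
    m          ∎
    where open ≡-Reasoning

  ∈Kˡ : ∀ {x} → x ∉ H → x ∈ˡ Kˡ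
  ∈Kˡ = ∈-elements⁺ ∘ x∉p⇒x∈∁p

  Kˡ∉ : ∀ {x} → x ∈ˡ Kˡ → x ∉ H
  Kˡ∉ = x∈∁p⇒x∉p ∘ ∈-elements⁻

  ε∈H : ε ∈ H
  ε∈H = proj₁ H≤G

  H∙H : ∀ {x y} → x ∈ H → y ∈ H → x ∙ y ∈ H
  H∙H = proj₁ (proj₂ H≤G) _ _

  H⁻¹ : ∀ {x} → x ∈ H → x ⁻¹ ∈ H
  H⁻¹ = proj₂ (proj₂ H≤G) _

  H∙K : ∀ {x y} → x ∈ H → y ∉ H → x ∙ y ∉ H
  H∙K {x} {y} x∈ y∉ xy∈ = y∉ (subst (_∈ H) (\\-leftDividesʳ x y) (H∙H (H⁻¹ x∈) xy∈))

  K∙H : ∀ {x y} → x ∉ H → y ∈ H → x ∙ y ∉ H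
  K∙H {x} {y} x∉ y∈ xy∈ = x∉ (subst (_∈ H) (//-rightDividesʳ y x) (H∙H xy∈ (H⁻¹ y∈)))

  K⁻¹ : ∀ {x} → x ∉ H → x ⁻¹ ∉ H
  K⁻¹ {x} x∉ x⁻¹∈ = x∉ (subst (_∈ H) (⁻¹-involutive x) (H⁻¹ x⁻¹∈))

  -- The translate x + H lies in K and has as many elements, so it is K. If x + y were in K,
  -- cancelling x would put y in H.
  K∙K : ∀ {x y} → x ∉ H → y ∉ H → x ∙ y ∈ H
  K∙K {x} {y} x∉ y∉ = decidable-stable (x ∙ y ∈? H) λ xy∉ →
    let h , h∈ , xy≡xh = ∈-map⁻ (x ∙_) (⊆-of-length _≟_ (Unique.map⁺ (∙-cancelˡ x _ _) (elements-unique H)) sub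
          (≤-reflexive (trans length-Kˡ (sym (trans (length-map _ Hˡ) length-Hˡ)))) (∈Kˡ xy∉))
    in y∉ (subst (_∈ H) (sym (∙-cancelˡ x _ _ xy≡xh)) (∈-elements⁻ h∈))
    where
    sub : ∀ {z} → z ∈ˡ map (x ∙_) Hˡ → z ∈ˡ Kˡ
    sub z∈ with ∈-map⁻ _ z∈
    ... | h , h∈ , refl = ∈Kˡ (K∙H x∉ (∈-elements⁻ h∈))

  sum∈H : ∀ {xs} → All (_∈ H) xs → sumList G xs ∈ H
  sum∈H []         = ε∈H
  sum∈H (x∈ ∷ xs∈) = H∙H x∈ (sum∈H xs∈)

  ∈∉-≢ : ∀ {x y} → x ∈ H → y ∉ H → x ≢ y
  ∈∉-≢ x∈ y∉ refl = y∉ x∈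

  -- Sums of a set S with at least m elements

  module Basis (S : Subset n) (ε∉S : ε ∉ S) (m≤S : m ≤ ∣ S ∣) where

    -- The entry `ε` of `A` is the option of taking no summand from H; it turns |S| ≥ m into the
    -- strict |A| + |B| > m needed for pigeonhole.
    A⁺ A B : List (Fin n)
    A⁺ = filter (_∈? H) (elements S)
    A  = ε ∷ A⁺
    B  = filter (¬? ∘ (_∈? H)) (elements S)

    A⁺⊆S : ∀ {x} → x ∈ˡ A⁺ → x ∈ S
    A⁺⊆S = ∈-elements⁻ ∘ proj₁ ∘ ∈-filter⁻ (_∈? H)

    A⁺⊆H : ∀ {x} → x ∈ˡ A⁺ → x ∈ H
    A⁺⊆H = proj₂ ∘ ∈-filter⁻ (_∈? H) {xs = elements S}

    A⊆H : ∀ {x} → x ∈ˡ A → x ∈ H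
    A⊆H (here refl) = ε∈H
    A⊆H (there x∈)  = A⁺⊆H x∈

    A∖ε⊆S : ∀ {x} → x ∈ˡ A → x ≢ ε → x ∈ S
    A∖ε⊆S (here refl) x≢ε = contradiction refl x≢ε
    A∖ε⊆S (there x∈)  _   = A⁺⊆S x∈

    A⁺≢ε : ∀ {x} → x ∈ˡ A⁺ → x ≢ ε
    A⁺≢ε x∈ refl = ε∉S (A⁺⊆S x∈)

    B⊆S : ∀ {x} → x ∈ˡ B → x ∈ S
    B⊆S = ∈-elements⁻ ∘ proj₁ ∘ ∈-filter⁻ (¬? ∘ (_∈? H))

    B⊆K : ∀ {x} → x ∈ˡ B → x ∉ H
    B⊆K = proj₂ ∘ ∈-filter⁻ (¬? ∘ (_∈? H)) {xs = elements S}

    uA⁺ : Unique A⁺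
    uA⁺ = Unique.filter⁺ (_∈? H) (elements-unique S)

    uA : Unique A
    uA = All.tabulate (λ x∈ → A⁺≢ε x∈ ∘ sym) ∷ uA⁺

    uB : Unique B
    uB = Unique.filter⁺ _ (elements-unique S)

    A+B : length A + length B ≡ suc ∣ S ∣
    A+B = cong suc (trans (length-filter-¬ (_∈? H) (elements S)) (length-elements S))

    -- A zero summand is dropped from the list; a nonzero one lies in H and so differs from the
    -- others, which lie in K.
    sum-A+K : ∀ {x xs} → x ∈ˡ A → xs ≢ [] → Unique xs → All (λ z → z ∈ S × z ∉ H) xs →
      InSums G S (x ∙ sumList G xs)
    sum-A+K {xs = xs} (here refl) xs≢[] uxs xs∈ = xs , xs≢[] , uxs , All.map proj₁ xs∈ , sym (identityˡ _)
    sum-A+K {x} {xs} (there x∈) _ uxs xs∈ =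
      x ∷ xs , (λ ()) , All.map (∈∉-≢ (A⁺⊆H x∈) ∘ proj₂) xs∈ ∷ uxs , A⁺⊆S x∈ ∷ All.map proj₁ xs∈ , refl

    B⊆S∖H : ∀ {y} → y ∈ˡ B → y ∈ S × y ∉ H
    B⊆S∖H y∈ = B⊆S y∈ , B⊆K y∈

    K⊆sums : ∀ {g} → g ∉ H → InSums G S g
    K⊆sums {g} g∉ with cover Hˡ {g} uA uB (∈-elements⁺ ∘ A⊆H) (λ y∈ → ∈-elements⁺ (K∙K g∉ (K⁻¹ (B⊆K y∈))))
        (subst₂ _<_ (sym length-Hˡ) (sym A+B) (s≤s m≤S))
    ... | x , y , x∈ , y∈ , refl = subst (λ z → InSums G S (x ∙ z)) (identityʳ y)
            (sum-A+K x∈ (λ ()) ([] ∷ []) (B⊆S∖H y∈ ∷ []))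

    -- Consequences of an element g of H that is not a sum

    module Stuck {g : Fin n} (g∈H : g ∈ H) (stuck : ¬ InSums G S g) where

      module _ {y : Fin n} (y∈B : y ∈ˡ B) where
        k : Fin n
        k = g ∙ y ⁻¹

        k∉H : k ∉ H
        k∉H = H∙K g∈H (K⁻¹ (B⊆K y∈B))

        B∖y D : List (Fin n)
        B∖y = remove _≟_ y B
        D   = map (λ z → k ∙ z ⁻¹) B∖y

        ∈B∖y : ∀ {z} → z ∈ˡ B∖y → z ∈ˡ B × z ≢ y
        ∈B∖y = ∈-filter⁻ _

        -- A common element a = g - y - w would give g = a + w + y with w and y distinct in B.
        A#D : ∀ {z} → ¬ (z ∈ˡ A × z ∈ˡ D)
        A#D (z∈A , z∈D) with ∈-map⁻ _ z∈D
        ... | w , w∈ , refl = stuck (subst (InSums G S)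
          (solve (g ∷ y ∷ w ∷ []) (((v0 ⊕ ⊖ v1) ⊕ ⊖ v2) ⊕ (v2 ⊕ (v1 ⊕ 𝟘))) v0 refl)
          (sum-A+K z∈A (λ ()) ((proj₂ (∈B∖y w∈) ∷ []) ∷ [] ∷ [])
            (B⊆S∖H (proj₁ (∈B∖y w∈)) ∷ B⊆S∖H y∈B ∷ [])))

        uAD : Unique (A ++ D)
        uAD = Unique.++⁺ uA (Unique.map⁺ (λ eq → ⁻¹-injective (∙-cancelˡ k _ _ eq)) (Unique.filter⁺ _ uB)) A#D

        AD⊆H : ∀ {z} → z ∈ˡ A ++ D → z ∈ˡ Hˡ
        AD⊆H z∈ with ∈-++⁻ A z∈
        ... | inj₁ z∈A = ∈-elements⁺ (A⊆H z∈A)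
        ... | inj₂ z∈D with ∈-map⁻ _ z∈D
        ...   | w , w∈ , refl = ∈-elements⁺ (K∙K k∉H (K⁻¹ (B⊆K (proj₁ (∈B∖y w∈)))))

        A+B≤1+AD : length A + length B ≤ suc (length (A ++ D))
        A+B≤1+AD = begin
          length A + length B              ≤⟨ +-monoʳ-≤ (length A) (length-remove _≟_ y uB) ⟩
          length A + suc (length B∖y)      ≡⟨ +-suc (length A) _ ⟩
          suc (length A + length B∖y)      ≡⟨ cong (λ l → suc (length A + l)) (length-map _ B∖y) ⟨
          suc (length A + length D)        ≡⟨ cong suc (length-++ A) ⟨
          suc (length (A ++ D))            ∎
          where open ≤-Reasoning

        -- `A` and `D` are disjoint inside H, and |D| is at least |B| - 1. Since |A| + |B| = |S| +
        -- 1, a stuck element forces |S| ≤ m.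
        A+B≤1+m : length A + length B ≤ suc m
        A+B≤1+m = ≤-trans A+B≤1+AD (s≤s (subst (length (A ++ D) ≤_) length-Hˡ (length-mono uAD AD⊆H)))

        abstract
          -- As |S| ≥ m, the disjoint `A` and `D` exhaust H. An h in `D` has the form k - w, and w
          -- is recovered as - h + k.
          dichotomy : ∀ {h} → h ∈ H → h ∈ˡ A ⊎ (h ⁻¹ ∙ k ∈ˡ B × h ⁻¹ ∙ k ≢ y)
          dichotomy {h} h∈ with ∈-++⁻ A (⊆-of-length _≟_ uAD AD⊆H
            (subst (_≤ length (A ++ D)) (sym length-Hˡ)
              (≤-pred (≤-trans (s≤s m≤S) (subst (_≤ suc (length (A ++ D))) A+B A+B≤1+AD))))
            (∈-elements⁺ h∈))
          ... | inj₁ h∈A = inj₁ h∈A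
          ... | inj₂ h∈D with ∈-map⁻ _ h∈D
          ...   | w , w∈ , refl = inj₂ (subst (λ z → z ∈ˡ B × z ≢ y)
                    (solve (k ∷ w ∷ []) v1 (⊖ (v0 ⊕ ⊖ v1) ⊕ v0) refl) (∈B∖y w∈))

        -- If the sum s were not in A, appending - s + k and y to the list would give g.
        sum∈A : ∀ xs → xs ≢ [] → Unique xs → All (_∈ˡ A⁺) xs → sumList G xs ∈ˡ A
        sum∈A xs xs≢[] uxs xs∈ with dichotomy (sum∈H (All.map A⁺⊆H xs∈))
        ... | inj₁ s∈A = s∈A
        ... | inj₂ (w∈ , w≢y) = contradiction
          (xs ++ w ∷ y ∷ [] , (λ { eq → xs≢[] (++-conicalˡ xs _ eq) }) ,
           Unique.++⁺ uxs ((w≢y ∷ []) ∷ [] ∷ []) disjoint ,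
           All.++⁺ (All.map A⁺⊆S xs∈) (B⊆S w∈ ∷ B⊆S y∈B ∷ []) ,
           trans (sum-++ xs) (solve (s ∷ g ∷ y ∷ []) (v0 ⊕ ((⊖ v0 ⊕ (v1 ⊕ ⊖ v2)) ⊕ (v2 ⊕ 𝟘))) v1 refl)) stuck
          where
          s = sumList G xs
          w = s ⁻¹ ∙ k
          sum-++ : ∀ xs {ys} → sumList G (xs ++ ys) ≡ sumList G xs ∙ sumList G ys
          sum-++ []       = sym (identityˡ _)
          sum-++ (x ∷ xs) = trans (cong (x ∙_) (sum-++ xs)) (sym (assoc x _ _))
          disjoint : ∀ {z} → ¬ (z ∈ˡ xs × z ∈ˡ w ∷ y ∷ [])
          disjoint (z∈ , here refl)         = B⊆K w∈ (A⁺⊆H (All.lookup xs∈ z∈))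
          disjoint (z∈ , there (here refl)) = B⊆K y∈B (A⁺⊆H (All.lookup xs∈ z∈))

        closed₂ : ∀ {a b} → a ∈ˡ A → b ∈ˡ A → a ≢ b → a ∙ b ∈ˡ A
        closed₂ (here refl) b∈          _   = subst (_∈ˡ A) (sym (identityˡ _)) b∈
        closed₂ (there a∈)  (here refl) _   = subst (_∈ˡ A) (sym (identityʳ _)) (there a∈)
        closed₂ (there a∈)  (there b∈)  a≢b = subst (λ z → _ ∙ z ∈ˡ A) (identityʳ _)
          (sum∈A _ (λ ()) ((a≢b ∷ []) ∷ [] ∷ []) (a∈ ∷ b∈ ∷ []))

        closed₃ : ∀ {a b c} → a ∈ˡ A → b ∈ˡ A → c ∈ˡ A → a ≢ b → a ≢ c → b ≢ c → a ∙ (b ∙ c) ∈ˡ A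
        closed₃ (here refl) b∈ c∈ _ _ b≢c = subst (_∈ˡ A) (sym (identityˡ _)) (closed₂ b∈ c∈ b≢c)
        closed₃ a∈@(there _) (here refl) c∈ _ a≢c _ =
          subst (λ z → _ ∙ z ∈ˡ A) (sym (identityˡ _)) (closed₂ a∈ c∈ a≢c)
        closed₃ a∈@(there _) b∈@(there _) (here refl) a≢b _ _ =
          subst (λ z → _ ∙ z ∈ˡ A) (sym (identityʳ _)) (closed₂ a∈ b∈ a≢b)
        closed₃ (there a∈) (there b∈) (there c∈) a≢b a≢c b≢c =
          subst (λ z → _ ∙ (_ ∙ z) ∈ˡ A) (identityʳ _)
            (sum∈A _ (λ ()) ((a≢b ∷ a≢c ∷ []) ∷ (b≢c ∷ []) ∷ [] ∷ []) (a∈ ∷ b∈ ∷ c∈ ∷ []))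

    A≤m : length A ≤ m
    A≤m = subst (length A ≤_) length-Hˡ (length-mono uA (∈-elements⁺ ∘ A⊆H))

    -- |A| ≤ m < |A| + |B|. This supplies the y from which the analysis of a stuck element starts.
    B-nonempty : ∃ (_∈ˡ B)
    B-nonempty = let y , y∈ , _ = escape _≟_ [] uB 0<B in y , y∈
      where
      0<B : 0 < length B
      0<B = +-cancelˡ-≤ m 1 (length B) (begin
        m + 1                ≡⟨ +-comm m 1 ⟩
        suc m                ≤⟨ s≤s m≤S ⟩
        suc ∣ S ∣            ≡⟨ A+B ⟨
        length A + length B  ≤⟨ +-monoˡ-≤ (length B) A≤m ⟩
        m + length B         ∎)
        where open ≤-Reasoning

    -- Counting alone settles this case, since a stuck element forces |S| ≤ m; it serves the upper
    -- bound for n = 6.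
    H⊆sums-large : m < ∣ S ∣ → ∀ {g} → g ∈ H → InSums G S g
    H⊆sums-large m<S {g} g∈ = decidable-stable (sums? S g) λ stuck →
      let y , y∈ = B-nonempty in
      <⇒≱ (s≤s m<S) (subst (_≤ suc m) A+B (Stuck.A+B≤1+m g∈ stuck y∈))

    module _ (4≤m : 4 ≤ m) where

      H-escape : ∀ xs → length xs < 4 → ∃ λ u → u ∈ H × u ∉ˡ xs
      H-escape xs xs<4 with escape _≟_ xs (elements-unique H) (subst (length xs <_) (sym length-Hˡ) (≤-trans xs<4 4≤m))
      ... | u , u∈ , u∉ = u , ∈-elements⁻ u∈ , u∉

      -- Take distinct nonzero x and y in H. If one of them is not its own opposite, it and its
      -- opposite sum to 0; otherwise x + y + (y + x) = 0.
      ε-sum-if-H⊆S : (∀ {h} → h ∈ H → h ≢ ε → h ∈ S) → InSums G S ε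
      ε-sum-if-H⊆S H⊆S with H-escape (ε ∷ []) (s≤s (s≤s z≤n))
      ... | x , x∈ , x∉ with H-escape (ε ∷ x ∷ []) (s≤s (s≤s (s≤s z≤n)))
      ... | y , y∈ , y∉ = cases (x ≟ x ⁻¹) (y ≟ y ⁻¹)
        where
        x≢ε : x ≢ ε
        x≢ε p = x∉ (here p)
        y≢ε : y ≢ ε
        y≢ε p = y∉ (here p)
        y≢x : y ≢ x
        y≢x p = y∉ (there (here p))
        opposite-pair : ∀ {z} → z ∈ H → z ≢ ε → z ≢ z ⁻¹ → InSums G S ε
        opposite-pair {z} z∈ z≢ε z≢z⁻¹ = z ∷ z ⁻¹ ∷ [] , (λ ()) , (z≢z⁻¹ ∷ []) ∷ [] ∷ [] ,
          H⊆S z∈ z≢ε ∷ H⊆S (H⁻¹ z∈) (λ p → z≢ε (⁻¹-injective (trans p (sym ε⁻¹≈ε)))) ∷ [] ,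
          solve (z ∷ []) (v0 ⊕ (⊖ v0 ⊕ 𝟘)) 𝟘 refl
        cases : Dec (x ≡ x ⁻¹) → Dec (y ≡ y ⁻¹) → InSums G S ε
        cases (no x≢x⁻¹)  _            = opposite-pair x∈ x≢ε x≢x⁻¹
        cases (yes _)     (no y≢y⁻¹)   = opposite-pair y∈ y≢ε y≢y⁻¹
        cases (yes x≡x⁻¹) (yes y≡y⁻¹)  =
          x ∷ y ∷ y ∙ x ∷ [] , (λ ()) ,
          ((y≢x ∘ sym) ∷ x≢yx y≢ε ∷ []) ∷ (x≢xy x≢ε ∷ []) ∷ [] ∷ [] ,
          H⊆S x∈ x≢ε ∷ H⊆S y∈ y≢ε ∷ H⊆S (H∙H y∈ x∈) yx≢ε ∷ [] , (begin
            x ∙ (y ∙ ((y ∙ x) ∙ ε))        ≡⟨ cong₂ (λ a b → a ∙ (b ∙ ((y ∙ x) ∙ ε))) x≡x⁻¹ y≡y⁻¹ ⟩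
            x ⁻¹ ∙ (y ⁻¹ ∙ ((y ∙ x) ∙ ε))  ≡⟨ solve (x ∷ y ∷ []) (⊖ v0 ⊕ (⊖ v1 ⊕ ((v1 ⊕ v0) ⊕ 𝟘))) 𝟘 refl ⟩
            ε                              ∎)
          where
          open ≡-Reasoning
          yx≢ε : y ∙ x ≢ ε
          yx≢ε p = y≢x (trans (inverseˡ-unique y x p) (sym x≡x⁻¹))

      H⊆sums-if-H⊆S : (∀ {h} → h ∈ H → h ≢ ε → h ∈ S) → ∀ {g} → g ∈ H → InSums G S g
      H⊆sums-if-H⊆S H⊆S {g} g∈ with g ≟ ε
      ... | yes refl = ε-sum-if-H⊆S H⊆S
      ... | no g≢ε   = g ∷ [] , (λ ()) , [] ∷ [] , H⊆S g∈ g≢ε ∷ [] , identityʳ g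

      -- No element of H is stuck when G is non-abelian and m ≥ 4

      module Impossible (¬ab : ¬ IsAbelian G) {g : Fin n} (g∈H : g ∈ H) (stuck : ¬ InSums G S g)
        {y₀ : Fin n} (y₀∈B : y₀ ∈ˡ B) where
        open Stuck g∈H stuck

        -- Here B = K, and g is stuck only if every element of K is a square root of g.
        module AllOfK (A⁺≡[] : A⁺ ≡ []) where
          K⊆B : ∀ {y} → y ∉ H → y ∈ˡ B
          K⊆B = ⊆-of-length _≟_ uB (∈Kˡ ∘ B⊆K) (begin
            length Kˡ  ≡⟨ length-Kˡ ⟩
            m          ≤⟨ m≤S ⟩
            ∣ S ∣      ≡⟨ suc-injective (trans (sym A+B) (cong (λ l → suc (length l) + length B) A⁺≡[])) ⟩
            length B   ∎) ∘ ∈Kˡ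
            where open ≤-Reasoning

          K⊆S : ∀ {y} → y ∉ H → y ∈ S
          K⊆S = B⊆S ∘ K⊆B

          -- Otherwise g - y and y are distinct elements of K, hence of S, with sum g.
          root : ∀ {y} → y ∉ H → y ∙ y ≡ g
          root {y} y∉ with g ∙ y ⁻¹ ≟ y
          ... | yes p = move-right y y g (sym p)
          ... | no ≢y = contradiction
            (g ∙ y ⁻¹ ∷ y ∷ [] , (λ ()) , (≢y ∷ []) ∷ [] ∷ [] , K⊆S (H∙K g∈H (K⁻¹ y∉)) ∷ K⊆S y∉ ∷ [] ,
             solve (g ∷ y ∷ []) ((v0 ⊕ ⊖ v1) ⊕ (v1 ⊕ 𝟘)) v0 refl) stuck

          x : Fin n
          x = y₀

          x∉H : x ∉ H
          x∉H = B⊆K y₀∈B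

          -- By `root`, (x + u) + (x + u) = g = x + x; cancel the leading x. Thus conjugation by x
          -- inverts H.
          uxu≡x : ∀ {u} → u ∈ H → u ∙ (x ∙ u) ≡ x
          uxu≡x {u} u∈ = ∙-cancelˡ x _ _ (trans (sym (assoc x u (x ∙ u))) (trans (root (K∙H x∉H u∈)) (sym (root x∉H))))

          -- Conjugation by x fixes g = x + x, yet inverts it by `uxu≡x`.
          gg≡ε : g ∙ g ≡ ε
          gg≡ε = ∙-cancelˡ x _ _ (begin
            x ∙ (g ∙ g)              ≡⟨ cong (λ w → x ∙ (w ∙ w)) (root x∉H) ⟨
            x ∙ ((x ∙ x) ∙ (x ∙ x))  ≡⟨ solve (x ∷ []) (v0 ⊕ ((v0 ⊕ v0) ⊕ (v0 ⊕ v0))) ((v0 ⊕ v0) ⊕ (v0 ⊕ (v0 ⊕ v0))) refl ⟩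
            (x ∙ x) ∙ (x ∙ (x ∙ x))  ≡⟨ cong (λ w → w ∙ (x ∙ w)) (root x∉H) ⟩
            g ∙ (x ∙ g)              ≡⟨ uxu≡x g∈H ⟩
            x                        ≡⟨ identityʳ x ⟨
            x ∙ ε                    ∎)
            where open ≡-Reasoning

          -- x inverts H by conjugation, so G would be abelian if H had exponent 2.
          nontrivial-double : ∃ λ u → u ∈ H × u ∙ u ≢ ε
          nontrivial-double with counterexample? (λ u → u ∙ u ≟ ε) Hˡ
          ... | inj₁ (u , u∈ , uu≢ε) = u , ∈-elements⁻ u∈ , uu≢ε
          ... | inj₂ exponent₂ = contradiction (commuting-large (x ∷ Hˡ)
              (All.tabulate (λ u∈ → ∈∉-≢ (∈-elements⁻ u∈) x∉H ∘ sym) ∷ elements-unique H) n<2L comm) ¬ab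
            where
            n<2L : n < suc (length Hˡ) + suc (length Hˡ)
            n<2L = subst₂ _<_ (sym n≡m+m) (cong (λ l → suc l + suc l) (sym length-Hˡ)) (s≤s (+-monoʳ-≤ m (n≤1+n m)))
            self-inverse : ∀ {u} → u ∈ H → u ≡ u ⁻¹
            self-inverse {u} u∈ = inverseˡ-unique u u (exponent₂ (∈-elements⁺ u∈))
            x-comm : ∀ {u} → u ∈ H → x ∙ u ≡ u ∙ x
            x-comm {u} u∈ = begin
              x ∙ u                ≡⟨ solve (x ∷ u ∷ []) (v0 ⊕ v1) (⊖ v1 ⊕ (v1 ⊕ (v0 ⊕ v1))) refl ⟩
              u ⁻¹ ∙ (u ∙ (x ∙ u)) ≡⟨ cong₂ _∙_ (sym (self-inverse u∈)) (uxu≡x u∈) ⟩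
              u ∙ x                ∎
              where open ≡-Reasoning
            comm : ∀ {u v} → u ∈ˡ x ∷ Hˡ → v ∈ˡ x ∷ Hˡ → u ∙ v ≡ v ∙ u
            comm (here refl) (here refl) = refl
            comm (here refl) (there v∈)  = x-comm (∈-elements⁻ v∈)
            comm (there u∈)  (here refl) = sym (x-comm (∈-elements⁻ u∈))
            comm {u} {v} (there u∈) (there v∈) = begin
              u ∙ v        ≡⟨ self-inverse (H∙H (∈-elements⁻ u∈) (∈-elements⁻ v∈)) ⟩
              (u ∙ v) ⁻¹   ≡⟨ ⁻¹-anti-homo-∙ u v ⟩
              v ⁻¹ ∙ u ⁻¹  ≡⟨ cong₂ _∙_ (self-inverse (∈-elements⁻ v∈)) (self-inverse (∈-elements⁻ u∈)) ⟨
              v ∙ u        ∎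
              where open ≡-Reasoning

          x+ : ∀ {u} → u ∈ H → x ∙ u ∈ S
          x+ u∈ = K⊆S (K∙H x∉H u∈)

          x+≢ : ∀ {u v} → u ≢ v → x ∙ u ≢ x ∙ v
          x+≢ u≢v p = u≢v (∙-cancelˡ x _ _ p)

          -- The elements x, x + a, x + b, x + c of K are distinct and lie in S, so their sum cannot
          -- be the stuck g. The two cases below choose a, b, c so that it is g.
          four-sum : ∀ {a b c} → a ∈ H → b ∈ H → c ∈ H → a ≢ ε → b ≢ ε → c ≢ ε → a ≢ b → a ≢ c → b ≢ c →
            x ∙ (x ∙ a ∙ (x ∙ b ∙ (x ∙ c ∙ ε))) ≢ g
          four-sum a∈ b∈ c∈ a≢ε b≢ε c≢ε a≢b a≢c b≢c eq = stuck (_ , (λ ()) ,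
            (x≢xy a≢ε ∷ x≢xy b≢ε ∷ x≢xy c≢ε ∷ []) ∷ (x+≢ a≢b ∷ x+≢ a≢c ∷ []) ∷ (x+≢ b≢c ∷ []) ∷ [] ∷ [] ,
            K⊆S x∉H ∷ x+ a∈ ∷ x+ b∈ ∷ x+ c∈ ∷ [] , eq)

          xxxx≡ε : (x ∙ x) ∙ (x ∙ x) ≡ ε
          xxxx≡ε = trans (cong (λ w → w ∙ w) (root x∉H)) gg≡ε

          -- With the choice u, u + v, v the sum regroups as 2x + (u + x + u) + (v + x + v) = 4x =
          -- 0.
          zero-case : g ≡ ε → ⊥
          zero-case g≡ε with H-escape (ε ∷ []) (s≤s (s≤s z≤n))
          -- Excluding - u keeps u + v nonzero; m ≥ 4 leaves room for all three exclusions.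
          ... | u , u∈ , u∉ with H-escape (ε ∷ u ∷ u ⁻¹ ∷ []) (s≤s (s≤s (s≤s (s≤s z≤n))))
          ... | v , v∈ , v∉ = four-sum u∈ (H∙H u∈ v∈) v∈ u≢ε uv≢ε v≢ε (x≢xy v≢ε) (v≢u ∘ sym) (x≢yx u≢ε ∘ sym) (begin
              x ∙ (x ∙ u ∙ (x ∙ (u ∙ v) ∙ (x ∙ v ∙ ε)))
                ≡⟨ solve (x ∷ u ∷ v ∷ []) (v0 ⊕ (v0 ⊕ v1 ⊕ (v0 ⊕ (v1 ⊕ v2) ⊕ (v0 ⊕ v2 ⊕ 𝟘))))
                     ((v0 ⊕ v0) ⊕ ((v1 ⊕ (v0 ⊕ v1)) ⊕ (v2 ⊕ (v0 ⊕ v2)))) refl ⟩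
              (x ∙ x) ∙ ((u ∙ (x ∙ u)) ∙ (v ∙ (x ∙ v)))
                ≡⟨ cong₂ (λ a b → (x ∙ x) ∙ (a ∙ b)) (uxu≡x u∈) (uxu≡x v∈) ⟩
              (x ∙ x) ∙ (x ∙ x)
                ≡⟨ xxxx≡ε ⟩
              ε
                ≡⟨ g≡ε ⟨
              g ∎)
            where
            open ≡-Reasoning
            u≢ε : u ≢ ε
            u≢ε p = u∉ (here p)
            v≢ε : v ≢ ε
            v≢ε p = v∉ (here p)
            v≢u : v ≢ u
            v≢u p = v∉ (there (here p))
            uv≢ε : u ∙ v ≢ ε
            uv≢ε p = v∉ (there (there (here (inverseʳ-unique u v p))))

          -- With the choice u, g, - u and g = 2x the sum is 2x + (u + 4x - u) = 2x = g. Since 2u is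
          -- nonzero while 2g = 0, the three elements are distinct.
          nonzero-case : g ≢ ε → ⊥
          nonzero-case g≢ε with nontrivial-double
          ... | u , u∈ , uu≢ε = four-sum u∈ g∈H (H⁻¹ u∈) u≢ε g≢ε u⁻¹≢ε u≢g u≢u⁻¹ g≢u⁻¹ (begin
              x ∙ (x ∙ u ∙ (x ∙ g ∙ (x ∙ u ⁻¹ ∙ ε)))
                ≡⟨ cong (λ w → x ∙ (x ∙ u ∙ (x ∙ w ∙ (x ∙ u ⁻¹ ∙ ε)))) (root x∉H) ⟨
              x ∙ (x ∙ u ∙ (x ∙ (x ∙ x) ∙ (x ∙ u ⁻¹ ∙ ε)))
                ≡⟨ solve (x ∷ u ∷ []) (v0 ⊕ (v0 ⊕ v1 ⊕ (v0 ⊕ (v0 ⊕ v0) ⊕ (v0 ⊕ ⊖ v1 ⊕ 𝟘))))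
                     ((v0 ⊕ v0) ⊕ (v1 ⊕ ((v0 ⊕ v0) ⊕ (v0 ⊕ v0)) ⊕ ⊖ v1)) refl ⟩
              (x ∙ x) ∙ (u ∙ ((x ∙ x) ∙ (x ∙ x)) ∙ u ⁻¹)
                ≡⟨ cong₂ (λ a b → a ∙ (u ∙ b ∙ u ⁻¹)) (root x∉H) xxxx≡ε ⟩
              g ∙ (u ∙ ε ∙ u ⁻¹)
                ≡⟨ solve (g ∷ u ∷ []) (v0 ⊕ (v1 ⊕ 𝟘 ⊕ ⊖ v1)) v0 refl ⟩
              g ∎)
            where
            open ≡-Reasoning
            u≢ε : u ≢ ε
            u≢ε refl = uu≢ε (identityˡ ε)
            u≢u⁻¹ : u ≢ u ⁻¹
            u≢u⁻¹ p = uu≢ε (trans (cong (u ∙_) p) (inverseʳ u))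
            u⁻¹≢ε : u ⁻¹ ≢ ε
            u⁻¹≢ε p = u≢ε (⁻¹-injective (trans p (sym ε⁻¹≈ε)))
            u≢g : u ≢ g
            u≢g refl = uu≢ε gg≡ε
            g≢u⁻¹ : g ≢ u ⁻¹
            g≢u⁻¹ p = u≢g (⁻¹-injective (trans (sym p) (inverseˡ-unique g g gg≡ε)))

          absurd : ⊥
          absurd with g ≟ ε
          ... | yes g≡ε = zero-case g≡ε
          ... | no g≢ε  = nonzero-case g≢ε

        -- The case where S meets H

        module LargeA (2≤A : 2 ≤ length A) where

          B<m : length B < length Kˡ
          B<m = subst (suc (length B) ≤_) (sym length-Kˡ) (≤-pred (≤-trans (+-monoˡ-≤ (length B) 2≤A) (A+B≤1+m y₀∈B)))

          -- Fix c in K outside B. The map sending y to g - y - c injects B into A: by `dichotomy`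
          -- for y, a value outside A would put c in B.
          B≤A : length B ≤ length A
          B≤A with escape _≟_ B (elements-unique (∁ H)) B<m
          ... | c , c∈ , c∉B = subst (_≤ length A) (length-map _ B) (length-mono (Unique.map⁺ inj uB) sub)
            where
            inj : ∀ {y z} → g ∙ y ⁻¹ ∙ c ⁻¹ ≡ g ∙ z ⁻¹ ∙ c ⁻¹ → y ≡ z
            inj eq = ⁻¹-injective (∙-cancelˡ g _ _ (∙-cancelʳ (c ⁻¹) _ _ eq))
            sub : ∀ {z} → z ∈ˡ map (λ y → g ∙ y ⁻¹ ∙ c ⁻¹) B → z ∈ˡ A
            sub z∈ with ∈-map⁻ _ z∈
            ... | y , y∈ , refl with dichotomy y∈ (K∙K (k∉H y∈) (K⁻¹ (Kˡ∉ c∈)))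
            ...   | inj₁ h∈A      = h∈A
            ...   | inj₂ (c∈B , _) = contradiction
              (subst (_∈ˡ B) (solve (g ∙ y ⁻¹ ∷ c ∷ []) (⊖ (v0 ⊕ ⊖ v1) ⊕ v0) v1 refl) c∈B) c∉B

          1+m≤2A : suc m ≤ length A + length A
          1+m≤2A = begin
            suc m                ≤⟨ s≤s m≤S ⟩
            suc ∣ S ∣            ≡⟨ A+B ⟨
            length A + length B  ≤⟨ +-monoʳ-≤ (length A) B≤A ⟩
            length A + length A  ∎
            where open ≤-Reasoning

          open DistinctlyClosed A uA (closed₂ y₀∈B)

          H⊆A+A : ∀ {h} → h ∈ H → ∃₂ λ a b → a ∈ˡ A × b ∈ˡ A × a ∙ b ≡ h
          H⊆A+A h∈ = cover Hˡ uA uA (∈-elements⁺ ∘ A⊆H) (λ a∈ → ∈-elements⁺ (H∙H h∈ (H⁻¹ (A⊆H a∈))))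
            (subst (_< length A + length A) (sym length-Hˡ) 1+m≤2A)

          closed : (∀ {a} → a ∈ˡ A → a ∙ a ∈ˡ A) → ∀ {a b} → a ∈ˡ A → b ∈ˡ A → a ∙ b ∈ˡ A
          closed double {a} {b} a∈ b∈ = case (a ≟ b)
            where
            case : Dec (a ≡ b) → a ∙ b ∈ˡ A
            case (no a≢b)  = closed₂ y₀∈B a∈ b∈ a≢b
            case (yes a≡b) = subst (λ z → a ∙ z ∈ˡ A) a≡b (double a∈)

          H⊆A : (∀ {a} → a ∈ˡ A → a ∙ a ∈ˡ A) → ∀ {h} → h ∈ H → h ∈ˡ A
          H⊆A double h∈ = let _ , _ , a∈ , b∈ , eq = H⊆A+A h∈ in subst (_∈ˡ A) eq (closed double a∈ b∈)

          -- If every double stayed in A, then A would be closed and H = A + A = A, so S would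
          -- contain all nonzero elements of H and g would be a sum.
          undoubled : ∃ λ a → a ∈ˡ A × ¬ (a ∙ a ∈ˡ A)
          undoubled with counterexample? (λ a → a ∙ a ∈ˡ? A) A
          ... | inj₁ p      = p
          ... | inj₂ double = contradiction (H⊆sums-if-H⊆S (λ h∈ → A∖ε⊆S (H⊆A double h∈)) g∈H) stuck

          no-double : ∀ {a} → a ∈ˡ A → a ≢ ε → a ∙ a ∉ˡ A
          no-double a∈ a≢ε aa∈ = let _ , b∈ , bb∉ = undoubled in bb∉ (all-double a∈ a≢ε aa∈ b∈)

          -- Opposites are unique, so this leaves room for at most two elements in `A⁺`.
          opposite⁺ : ∀ {a b} → a ∈ˡ A⁺ → b ∈ˡ A⁺ → a ≢ b → a ∙ b ≡ ε
          opposite⁺ a∈ b∈ = opposite (closed₃ y₀∈B) no-double (there a∈) (there b∈) (A⁺≢ε a∈) (A⁺≢ε b∈)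

          -- The remaining case A = {0, x, - x} with 2x ∉ A: k = g - y₀ commutes with x, and
          -- {0, x, - x, 2x} + {0, k} is more than half of G.
          module Triple {x : Fin n} (A⁺≡ : A⁺ ≡ x ∷ x ⁻¹ ∷ []) where
            x∈A⁺ : x ∈ˡ A⁺
            x∈A⁺ = subst (x ∈ˡ_) (sym A⁺≡) (here refl)

            x⁻¹∈A⁺ : x ⁻¹ ∈ˡ A⁺
            x⁻¹∈A⁺ = subst (x ⁻¹ ∈ˡ_) (sym A⁺≡) (there (here refl))

            x∈H : x ∈ H
            x∈H = A⁺⊆H x∈A⁺

            x≢ε : x ≢ ε
            x≢ε = A⁺≢ε x∈A⁺

            xx∉A : x ∙ x ∉ˡ A
            xx∉A = no-double (there x∈A⁺) x≢ε

            x≢x⁻¹ : x ≢ x ⁻¹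
            x≢x⁻¹ p = xx∉A (here (trans (cong (x ∙_) p) (inverseʳ x)))

            κ : Fin n
            κ = k y₀∈B

            κ∉H : κ ∉ H
            κ∉H = k∉H y₀∈B

            -- Otherwise (- x) + κ + (- x) = κ, which is x + w + (- x) + y₀ = g for w = - 2x + κ.
            not-inverted : κ ∙ x ∙ κ ⁻¹ ≢ x ⁻¹
            not-inverted p with dichotomy y₀∈B (H∙H x∈H x∈H)
            ... | inj₁ xx∈A = xx∉A xx∈A
            ... | inj₂ (w∈ , w≢y₀) = stuck
              (x ∷ w ∷ x ⁻¹ ∷ y₀ ∷ [] , (λ ()) ,
               (∈∉-≢ x∈H (B⊆K w∈) ∷ x≢x⁻¹ ∷ ∈∉-≢ x∈H (B⊆K y₀∈B) ∷ []) ∷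
               (∈∉-≢ (H⁻¹ x∈H) (B⊆K w∈) ∘ sym ∷ w≢y₀ ∷ []) ∷
               (∈∉-≢ (H⁻¹ x∈H) (B⊆K y₀∈B) ∷ []) ∷ [] ∷ [] ,
               A⁺⊆S x∈A⁺ ∷ B⊆S w∈ ∷ A⁺⊆S x⁻¹∈A⁺ ∷ B⊆S y₀∈B ∷ [] , (begin
                 x ∙ (w ∙ (x ⁻¹ ∙ (y₀ ∙ ε)))
                   ≡⟨ solve (x ∷ κ ∷ y₀ ∷ []) (v0 ⊕ (⊖ (v0 ⊕ v0) ⊕ v1 ⊕ (⊖ v0 ⊕ (v2 ⊕ 𝟘)))) (⊖ v0 ⊕ (v1 ⊕ ⊖ v0 ⊕ v2)) refl ⟩
                 x ⁻¹ ∙ (κ ∙ x ⁻¹ ∙ y₀)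
                   ≡⟨ cong (_∙ (κ ∙ x ⁻¹ ∙ y₀)) p ⟨
                 κ ∙ x ∙ κ ⁻¹ ∙ (κ ∙ x ⁻¹ ∙ y₀)
                   ≡⟨ solve (x ∷ g ∷ y₀ ∷ []) (v1 ⊕ ⊖ v2 ⊕ v0 ⊕ ⊖ (v1 ⊕ ⊖ v2) ⊕ (v1 ⊕ ⊖ v2 ⊕ ⊖ v0 ⊕ v2)) v1 refl ⟩
                 g ∎))
              where
              open ≡-Reasoning
              w = (x ∙ x) ⁻¹ ∙ κ

            -- Apply `dichotomy` to the conjugate c = κ + x - κ. Within A it cannot be 0, nor - x by
            -- `not-inverted`, so it is x. Outside A, w = - c + κ = κ - x lies in B and w + x + y₀ =
            -- g.
            commute : x ∙ κ ≡ κ ∙ x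
            commute with dichotomy y₀∈B (K∙K (K∙H κ∉H x∈H) (K⁻¹ κ∉H))
            ... | inj₁ (here c≡ε)  = contradiction (trans (sym (identityˡ κ)) (move-right ε κ (κ ∙ x) (sym c≡ε))) (x≢xy x≢ε)
            ... | inj₁ (there c∈) with subst (κ ∙ x ∙ κ ⁻¹ ∈ˡ_) A⁺≡ c∈
            ...   | here c≡x           = move-right x κ (κ ∙ x) (sym c≡x)
            ...   | there (here c≡x⁻¹) = contradiction c≡x⁻¹ not-inverted
            commute | inj₂ (w∈ , w≢y₀) = contradiction
              (w ∷ x ∷ y₀ ∷ [] , (λ ()) ,
               (∈∉-≢ x∈H (B⊆K w∈) ∘ sym ∷ w≢y₀ ∷ []) ∷ (∈∉-≢ x∈H (B⊆K y₀∈B) ∷ []) ∷ [] ∷ [] ,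
               B⊆S w∈ ∷ A⁺⊆S x∈A⁺ ∷ B⊆S y₀∈B ∷ [] ,
               solve (g ∷ y₀ ∷ x ∷ []) ((⊖ (v0 ⊕ ⊖ v1 ⊕ v2 ⊕ ⊖ (v0 ⊕ ⊖ v1)) ⊕ (v0 ⊕ ⊖ v1)) ⊕ (v2 ⊕ (v1 ⊕ 𝟘))) v0 refl) stuck
              where w = (κ ∙ x ∙ κ ⁻¹) ⁻¹ ∙ κ

            length-A : length A ≡ 3
            length-A = cong (suc ∘ length) A⁺≡

            -- From m + 1 ≤ 2|A| = 6 follows n ≤ 10. The bound 16 is twice the size of the
            -- eight-element set {0, κ} + `L₀`.
            n<16 : n < 16
            n<16 = subst (_< 16) (sym n≡m+m) (s≤s (≤-trans (+-mono-≤ m≤5 m≤5) (m≤m+n 10 5)))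
              where
              m≤5 : m ≤ 5
              m≤5 = ≤-pred (subst (λ l → suc m ≤ l + l) length-A 1+m≤2A)

            absurd : ⊥
            absurd = ¬ab (two-generated-large commute (L₀ ++ map (κ ∙_) L₀)
              (Unique.++⁺ uL₀ (Unique.map⁺ (∙-cancelˡ κ _ _) uL₀) disjoint) n<16
              λ P Pε ∙P P⁻¹ Px Pκ → let
                PL₀ = Pε ∷ Px ∷ P⁻¹ Px ∷ ∙P Px Px ∷ []
                in All.++⁺ PL₀ (All.map⁺ (All.map (∙P Pκ) PL₀)))
              where
              L₀ : List (Fin n)
              L₀ = ε ∷ x ∷ x ⁻¹ ∷ x ∙ x ∷ []
              uL₀ : Unique L₀
              uL₀ = (x≢ε ∘ sym ∷ A⁺≢ε x⁻¹∈A⁺ ∘ sym ∷ (λ p → xx∉A (here (sym p))) ∷ []) ∷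
                    (x≢x⁻¹ ∷ x≢xy x≢ε ∷ []) ∷
                    ((λ p → xx∉A (subst (_∈ˡ A) p (there x⁻¹∈A⁺))) ∷ []) ∷ [] ∷ []
              L₀⊆H : All (_∈ H) L₀
              L₀⊆H = ε∈H ∷ x∈H ∷ H⁻¹ x∈H ∷ H∙H x∈H x∈H ∷ []
              disjoint : ∀ {z} → ¬ (z ∈ˡ L₀ × z ∈ˡ map (κ ∙_) L₀)
              disjoint (z∈ , κz∈) with ∈-map⁻ (κ ∙_) {xs = L₀} κz∈
              ... | w , w∈ , refl = K∙H κ∉H (All.lookup L₀⊆H w∈) (All.lookup L₀⊆H z∈)

          absurd : ∀ xs → A⁺ ≡ xs → ⊥
          absurd [] eq with subst (2 ≤_) (cong (suc ∘ length) eq) 2≤A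
          ... | s≤s ()
          -- Here |A| = 2, so m + 1 ≤ 4, against m ≥ 4.
          absurd (a ∷ []) eq with ≤-trans 4≤m (≤-pred (subst (λ l → suc m ≤ l + l) (cong (suc ∘ length) eq) 1+m≤2A))
          ... | s≤s (s≤s (s≤s ()))
          absurd (a ∷ b ∷ []) eq = Triple.absurd (trans eq (cong (λ z → a ∷ z ∷ [])
            (inverseʳ-unique a b (opposite⁺ a∈ b∈ a≢b))))
            where
            a∈ = subst (a ∈ˡ_) (sym eq) (here refl)
            b∈ = subst (b ∈ˡ_) (sym eq) (there (here refl))
            a≢b : a ≢ b
            a≢b with subst Unique eq uA⁺
            ... | (a≢b ∷ []) ∷ _ = a≢b
          -- Both b and c would be the opposite of a.
          absurd (a ∷ b ∷ c ∷ _) eq with subst Unique eq uA⁺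
          ... | (a≢b ∷ a≢c ∷ _) ∷ (b≢c ∷ _) ∷ _ =
            b≢c (∙-cancelˡ a _ _ (trans (opposite⁺ a∈ b∈ a≢b) (sym (opposite⁺ a∈ c∈ a≢c))))
            where
            a∈ = subst (a ∈ˡ_) (sym eq) (here refl)
            b∈ = subst (b ∈ˡ_) (sym eq) (there (here refl))
            c∈ = subst (c ∈ˡ_) (sym eq) (there (there (here refl)))

        absurd : ∀ xs → A⁺ ≡ xs → ⊥
        absurd []       eq = AllOfK.absurd eq
        absurd (x ∷ xs) eq = LargeA.absurd (subst (2 ≤_) (cong (suc ∘ length) (sym eq)) (s≤s (s≤s z≤n))) _ refl

      basis : ¬ IsAbelian G → IsAdditiveBasis G S
      basis ¬ab g with g ∈? H
      ... | no g∉H  = K⊆sums g∉H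
      ... | yes g∈H = decidable-stable (sums? S g) λ stuck → Impossible.absurd ¬ab g∈H stuck (proj₂ B-nonempty) _ refl

  -- Sharpness of the bound m

  K-nonempty : ∃ (_∉ H)
  K-nonempty with escape _≟_ [] (elements-unique (∁ H))
                    (subst (0 <_) (trans length-Hˡ (sym length-Kˡ)) (∈-length (∈-elements⁺ ε∈H)))
  ... | x , x∈ , _ = x , Kˡ∉ x∈

  -- The set H without 0 has at least m - 1 elements, and its sums never leave H. A bound t < m
  -- would apply to it and produce an element of K.
  m≤critical : ∀ t → CritBound G t → m ≤ t
  m≤critical t bound = ≮⇒≥ λ t<m →
    let x , x∉H = K-nonempty
        xs , _ , _ , xs∈S , sum≡x = bound S ε∉S (≤-pred (≤-trans t<m m≤1+S)) x
    in x∉H (subst (_∈ H) sum≡x (sum∈H (All.map (proj₁ ∘ x∈p∩q⁻ H _) xs∈S)))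
    where
    S : Subset n
    S = H ∩ ∁ ⁅ ε ⁆
    ε∉S : ε ∉ S
    ε∉S ε∈S = x∈∁p⇒x∉p (proj₂ (x∈p∩q⁻ H _ ε∈S)) (x∈⁅x⁆ ε)
    H⊆ε∷S : ∀ {x} → x ∈ˡ Hˡ → x ∈ˡ ε ∷ elements S
    H⊆ε∷S {x} x∈ with x ≟ ε
    ... | yes x≡ε = here x≡ε
    ... | no x≢ε  = there (∈-elements⁺ (x∈p∩q⁺ {p = H} (∈-elements⁻ x∈ , x∉p⇒x∈∁p (x≢y⇒x∉⁅y⁆ x≢ε))))
    m≤1+S : m ≤ suc ∣ S ∣
    m≤1+S = subst₂ (λ a b → a ≤ suc b) length-Hˡ (length-elements S) (length-mono (elements-unique H) H⊆ε∷S)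

  -- Groups of order 6

  module OrderSix (¬ab : ¬ IsAbelian G) (m≡3 : m ≡ 3) where

    n<8 : n < 8
    n<8 = subst (_< 8) (sym (trans n≡m+m (cong₂ _+_ m≡3 m≡3))) (m≤m+n 7 1)

    -- If 2y were nonzero, then 0, y, 2y, 3y would be distinct, as H and K alternate. They commute
    -- and fill more than half of G, so G would be abelian.
    K-involutive : ∀ {y} → y ∉ H → y ∙ y ≡ ε
    K-involutive {y} y∉ with y ∙ y ≟ ε
    ... | yes p = p
    ... | no yy≢ε = contradiction
      (two-generated-large {y} {y} refl (ε ∷ y ∷ y ∙ y ∷ y ∙ (y ∙ y) ∷ [])
        ((∈∉-≢ ε∈H y∉ ∷ yy≢ε ∘ sym ∷ ∈∉-≢ ε∈H yyy∉ ∷ []) ∷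
         (∈∉-≢ yy∈ y∉ ∘ sym ∷ x≢xy yy≢ε ∷ []) ∷ (∈∉-≢ yy∈ yyy∉ ∷ []) ∷ [] ∷ [])
        n<8 (λ P Pε ∙P _ Py _ → Pε ∷ Py ∷ ∙P Py Py ∷ ∙P Py (∙P Py Py) ∷ [])) ¬ab
      where
      yy∈ : y ∙ y ∈ H
      yy∈ = K∙K y∉ y∉
      yyy∉ : y ∙ (y ∙ y) ∉ H
      yyy∉ = K∙H y∉ yy∈

    -- Sums of one or three elements of K lie in K; x + y = 0 = x + x would force y = x; and K has
    -- only three elements.
    ε∉sums-K : ¬ InSums G (∁ H) ε
    ε∉sums-K ([] , xs≢[] , _) = xs≢[] refl
    ε∉sums-K (x ∷ [] , _ , _ , x∈ ∷ [] , eq) = x∈∁p⇒x∉p x∈ (subst (_∈ H) (trans (sym eq) (identityʳ x)) ε∈H)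
    ε∉sums-K (x ∷ y ∷ [] , _ , (x≢y ∷ []) ∷ _ , x∈ ∷ _ , eq) = x≢y (∙-cancelˡ x _ _ (begin
      x ∙ x        ≡⟨ K-involutive (x∈∁p⇒x∉p x∈) ⟩
      ε            ≡⟨ eq ⟨
      x ∙ (y ∙ ε)  ≡⟨ cong (x ∙_) (identityʳ y) ⟩
      x ∙ y        ∎))
      where open ≡-Reasoning
    ε∉sums-K (x ∷ y ∷ z ∷ [] , _ , _ , x∈ ∷ y∈ ∷ z∈ ∷ [] , eq) =
      K∙H (x∈∁p⇒x∉p x∈) (K∙K (x∈∁p⇒x∉p y∈) (K∙H (x∈∁p⇒x∉p z∈) ε∈H)) (subst (_∈ H) (sym eq) ε∈H)
    ε∉sums-K (x ∷ y ∷ z ∷ w ∷ xs , _ , uxs , xs∈ , _) =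
      contradiction (subst (4 + length xs ≤_) (trans length-Kˡ m≡3)
        (length-mono uxs λ u∈ → ∈-elements⁺ (All.lookup xs∈ u∈))) λ { (s≤s (s≤s (s≤s ()))) }

    critical : IsCriticalNumber G 4
    critical = upper , lower
      where
      upper : CritBound G 4
      upper S ε∉S 4≤S g with g ∈? H
      ... | yes g∈ = Basis.H⊆sums-large S ε∉S (≤-trans (n≤1+n m) m<S) m<S g∈
        where
        m<S : m < ∣ S ∣
        m<S = subst (_< ∣ S ∣) (sym m≡3) 4≤S
      ... | no g∉ = Basis.K⊆sums S ε∉S (subst (_≤ ∣ S ∣) (sym m≡3) (≤-trans (n≤1+n 3) 4≤S)) g∉
      lower : ∀ t → CritBound G t → 4 ≤ t
      lower t bound = ≮⇒≥ λ t<4 → ε∉sums-K (bound (∁ H) (x∈p⇒x∉∁p ε∈H)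
        (≤-trans (≤-pred t<4) (≤-reflexive (trans (sym m≡3) (trans (sym length-Kˡ) (length-elements (∁ H)))))) ε)

  critical : ¬ IsAbelian G → 4 ≤ m → IsCriticalNumber G m
  critical ¬ab 4≤m = (λ S ε∉S m≤S → Basis.basis S ε∉S m≤S 4≤m ¬ab) , m≤critical

-- A non-abelian group has at least five elements; with even order other than 6 this leaves n ≥ 8,
-- which supplies the hypothesis m ≥ 4 of the general case.
5≤2m≢6⇒4≤m : ∀ m → 5 ≤ m * 2 → m * 2 ≢ 6 → 4 ≤ m
5≤2m≢6⇒4≤m 0 ()
5≤2m≢6⇒4≤m 1 (s≤s (s≤s ()))
5≤2m≢6⇒4≤m 2 (s≤s (s≤s (s≤s (s≤s ()))))
5≤2m≢6⇒4≤m 3 _ 6≢6 = contradiction refl 6≢6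
5≤2m≢6⇒4≤m (suc (suc (suc (suc m)))) _ _ = s≤s (s≤s (s≤s (s≤s z≤n)))

theorem1p3 : (n : ℕ) (G : FinGroup n) → ¬ IsAbelian G → 2 ∣ n → HasSubgroupOfIndex2 G →
    (n ≡ 6 → IsCriticalNumber G 4) × (n ≢ 6 → IsCriticalNumber G (n / 2))
theorem1p3 n G ¬ab _ (H , H≤G , index) =
  (λ n≡6 → IndexTwo.OrderSix.critical G H H≤G index ¬ab (*-cancelʳ-≡ ∣ H ∣ 3 2 (trans index n≡6))) ,
  (λ n≢6 → subst (IsCriticalNumber G) ∣H∣≡n/2 (IndexTwo.critical G H H≤G index ¬ab
    (5≤2m≢6⇒4≤m ∣ H ∣ (subst (5 ≤_) (sym index) (FiniteGroup.nonabelian⇒5≤n G ¬ab)) (n≢6 ∘ trans (sym index)))))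
  where
  ∣H∣≡n/2 : ∣ H ∣ ≡ n / 2
  ∣H∣≡n/2 = trans (sym (m*n/n≡m ∣ H ∣ 2)) (cong (_/ 2) index)
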